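{- Let $p$ be a prime, $f\ge1$ and $q=p^f$, and regard $\mathbb{F}_q^\times=\mathbb{F}_q\setminus\{0\}$ as a subset of the additive group of $\mathbb{F}_q$. (1) If $p$ is odd, then $\mathbb{F}_q^\times$ is a GAP. More precisely: if $f=1$, it is an arithmetic progression; if $f>1$, it is not a proper GAP of any rank, but it has an improper GAP representation of rank at most $2f$. (2) If $p=2$, then $\mathbb{F}_q^\times$ is a GAP if and only if $q=2$.
   Context: For $r\ge1$, a rank-$r$ generalized arithmetic progression (GAP) in an abelian group is a set $P=a+[0,L_1-1]d_1+\cdots+[0,L_r-1]d_r=\{a+n_1d_1+\cdots+n_rd_r : n_i\in\mathbb{Z},\ 0\le n_i\le L_i-1\}$, where $L_i\ge 2$ are integers and each $d_i\neq 0$. The representation is proper when the parameter map $(n_1,\dots,n_r)\mapsto a+\sum_i n_id_i$ is injective on the box $\prod_i\{0,\dots,L_i-1\}$, equivalently $|P|=L_1\cdots L_r$; otherwise it is improper. A singleton is regarded as a rank-zero GAP. A set is a GAP if it is a GAP of some rank $r\ge 0$, and a proper GAP if it has some proper representation. An arithmetic progression is a set of the form $\{a+nd: 0\le n\le L-1\}$. -}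

module Defs where

open import Algebra.Bundles using (AbelianGroup; CommutativeRing)
open import Data.Fin.Base using (Fin; toℕ)
open import Data.Nat.Base using (ℕ; _≤_)
open import Data.Product.Base using (Σ; ∃; _×_)
open import Function.Bundles using (Inverse)
open import Level using (Level; _⊔_; suc)
open import Relation.Binary.PropositionalEquality as ≡ using (_≡_)
open import Relation.Nullary.Negation using (¬_)
open import Relation.Unary using (Pred; _≐_)
import Algebra.Definitions.RawMonoid as RawMonoidDefs

module _ {c ℓ : Level} (G : AbelianGroup c ℓ) where
  open AbelianGroup G using (Carrier; _≈_; ε; rawMonoid) renaming (_∙_ to _+_)
  open RawMonoidDefs rawMonoid using (sum) renaming (_×_ to _·_)

  -- The data (a; L₁,…,Lᵣ; d₁,…,dᵣ) of a rank-r representation.  For r = 0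
  -- the only datum is the point a, and the set represented is {a}.
  record GAPRep (r : ℕ) : Set (c ⊔ ℓ) where
    field
      base   : Carrier
      len    : Fin r → ℕ
      step   : Fin r → Carrier
      len≥2  : ∀ i → 2 ≤ len i
      step≉ε : ∀ i → ¬ (step i ≈ ε)

    Box : Set
    Box = ∀ i → Fin (len i)

    point : Box → Carrier
    point n = base + sum (λ i → toℕ (n i) · step i)

    ⟦_⟧ : Pred Carrier ℓ
    ⟦_⟧ x = Σ Box λ n → x ≈ point n

    -- Injectivity of the parameter map.  Tuples are compared coordinatewise,
    -- since _≡_ on functions would need function extensionality.
    Proper : Set ℓ
    Proper = ∀ (m n : Box) → point m ≈ point n → ∀ i → m i ≡ n i

    Improper : Set ℓ
    Improper = ¬ Proper

  open GAPRep using (⟦_⟧; Proper)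

  IsGAP : ∀ {s} → Pred Carrier s → Set (c ⊔ ℓ ⊔ s)
  IsGAP S = ∃ λ r → Σ (GAPRep r) λ P → S ≐ ⟦ P ⟧

  IsProperGAP : ∀ {s} → Pred Carrier s → Set (c ⊔ ℓ ⊔ s)
  IsProperGAP S = ∃ λ r → Σ (GAPRep r) λ P → (S ≐ ⟦ P ⟧) × Proper P

  IsArithmeticProgression : ∀ {s} → Pred Carrier s → Set (c ⊔ ℓ ⊔ s)
  IsArithmeticProgression S =
    Σ Carrier λ a → Σ Carrier λ d → Σ ℕ λ L →
      S ≐ (λ x → Σ (Fin L) λ n → x ≈ a + (toℕ n · d))

-- A field with exactly q elements (counted up to _≈_).
record FiniteField (c ℓ : Level) (q : ℕ) : Set (suc (c ⊔ ℓ)) where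
  field
    commutativeRing : CommutativeRing c ℓ

  open CommutativeRing commutativeRing public

  field
    0≉1         : ¬ (0# ≈ 1#)
    inverse     : ∀ x → ¬ (x ≈ 0#) → ∃ λ y → x * y ≈ 1#
    enumeration : Inverse setoid (≡.setoid (Fin q))

  Nonzero : Pred Carrier ℓ
  Nonzero x = ¬ (x ≈ 0#)

-- Improper representation (p odd, f = k + 1 > 1).  For a basis e₀,…,e_k over 𝔽_p consider
--   e₀ + Σ_{i≤k} [0,p−2]eᵢ + Σ_{i<k} [0,1](eᵢ + eᵢ₊₁) + [0,1](e_k − e₀),
-- with parameters nᵢ ∈ [0,p−2] and bits zᵢ.  For i ≥ 1 the coefficient of eᵢ is nᵢ + zᵢ₋₁ + zᵢ
-- with nᵢ ≠ −1, so if it vanishes then zᵢ₋₁ = zᵢ.  When all of them vanish, z₀ = z_k and the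
-- coefficient of e₀ is 1 + n₀ ≠ 0: the element 0 is not represented.  A nonzero coefficient of eᵢ
-- can be reached with zᵢ ≠ zᵢ₋₁ from either bit, and with zᵢ = zᵢ₋₁ from at least one, which
-- is enough freedom to represent every other element.
--
-- No proper representation (f > 1).  Let d be the first step and L its length.  Then L < p, as
-- otherwise 0 would be represented; this alone settles p = 2.  On a coset x + ⟨d⟩ avoiding 0,
-- properness makes the first parameter increase by 1 modulo L with each step d, so L ∣ p.
module Submission where

open import Defs
open import Algebra.Bundles using (AbelianGroup)
open import Data.Fin.Base as Fin using (Fin; zero; suc; toℕ; fromℕ<; funToFin; finToFun)
open import Data.Fin.Permutation using (Permutation′; permutation; _⟨$⟩ʳ_)
open import Data.Fin.Properties using
  ( any?; all?; ¬∀⟶∃¬; pigeonhole; injective⇒≤; toℕ<n; toℕ-fromℕ<; toℕ-injective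
  ; funToFin-finToFin; finToFun-funToFin )
open import Data.Nat.Base using
  ( ℕ; zero; suc; _+_; _∸_; _≤_; _<_; _*_; _^_; _/_; s≤s; z<s; s<s; >-nonZero )
open import Data.Nat.Coprimality using (Coprime; coprime-Bézout)
open import Data.Nat.DivMod using (_mod_; m%n<n; m≡m%n+[m/n]*n)
open import Data.Nat.Divisibility using (_∣_; _∣?_; divides; >⇒∤; ∣m+n∣m⇒∣n; ∣m∣n⇒∣m+n; n∣m*n; _∣0)
open import Data.Nat.GCD using (module Bézout)
open import Data.Nat.Primality using (Prime; prime⇒irreducible; ¬prime[0]; ¬prime[1])
open import Data.Nat.Solver using (module +-*-Solver)
open import Data.Product.Base using (Σ; ∃; ∃₂; _×_; _,_; proj₁; proj₂)
open import Data.Sum.Base using (_⊎_; inj₁; inj₂)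
open import Data.Unit.Polymorphic.Base using (⊤; tt)
open import Data.Vec.Functional using (Vector; _∷_; []; head; tail; replicate)
open import Function.Base using (_∘_)
open import Function.Bundles using (_⇔_; mk⇔; module Inverse)
open import Level using (Level)
open import Relation.Binary.Definitions using (Decidable)
open import Relation.Binary.PropositionalEquality as ≡ using (_≡_; _≢_)
open import Relation.Nullary.Decidable using (Dec; yes; no; map′)
open import Relation.Nullary.Negation using (¬_; contradiction)
open import Relation.Unary using (_≐_)
import Algebra.Definitions.RawMonoid as RawMonoidDefs
import Algebra.Properties.CommutativeMonoid.Mult as MultProperties
import Algebra.Properties.CommutativeMonoid.Sum as SumProperties
import Algebra.Properties.Group as GroupProperties
import Algebra.Properties.Semiring.Mult as SemiringMult
import Algebra.Solver.CommutativeMonoid as CommutativeMonoidSolver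
import Data.Fin.Properties as Fin
import Data.Nat.Properties as ℕ
import Relation.Binary.Reasoning.Setoid as SetoidReasoning

-- Counting in finite sets.

∃-not-in-image : ∀ {m n} → m < n → (g : Fin m → Fin n) → ∃ λ y → ∀ x → g x ≢ y
∃-not-in-image {m} {n} m<n g with all? (λ y → any? (λ x → g x Fin.≟ y))
... | no ¬onto =
  let y , y∉ = ¬∀⟶∃¬ n _ (λ y → any? (λ x → g x Fin.≟ y)) ¬onto
  in y , λ x gx≡y → y∉ (x , gx≡y)
-- Chosen preimages would map `Fin n` injectively into the smaller `Fin m`.
... | yes onto =
  let i , j , i<j , eq = pigeonhole m<n (λ y → proj₁ (onto y))
      i≡j = ≡.trans (≡.sym (proj₂ (onto i))) (≡.trans (≡.cong g eq) (proj₂ (onto j)))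
  in contradiction (≡.cong toℕ i≡j) (λ e → ℕ.<-irrefl e i<j)

funToFin-cong : ∀ {m n} {g h : Fin m → Fin n} → (∀ i → g i ≡ h i) → funToFin g ≡ funToFin h
funToFin-cong {zero}  eq = ≡.refl
funToFin-cong {suc m} eq = ≡.cong₂ Fin.combine (eq zero) (funToFin-cong (eq ∘ suc))

-- Building and unfolding representations one direction at a time.

module _ {c ℓ : Level} (G : AbelianGroup c ℓ) where
  open AbelianGroup G
  open RawMonoidDefs rawMonoid using (sum) renaming (_×_ to _·_)
  open GAPRep

  pointRep : Carrier → GAPRep G 0
  pointRep a = record
    { base = a ; len = λ () ; step = λ () ; len≥2 = λ () ; step≉ε = λ () }

  consRep : ∀ {r} (L : ℕ) (d : Carrier) → 2 ≤ L → ¬ d ≈ ε → GAPRep G r → GAPRep G (suc r)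
  consRep L d 2≤L d≉ε P = record
    { base   = base P
    ; len    = L ∷ len P
    ; step   = d ∷ step P
    ; len≥2  = λ { zero → 2≤L ; (suc i) → len≥2 P i }
    ; step≉ε = λ { zero → d≉ε ; (suc i) → step≉ε P i }
    }

  tailRep : ∀ {r} → GAPRep G (suc r) → GAPRep G r
  tailRep P = record
    { base   = base P
    ; len    = tail (len P)
    ; step   = tail (step P)
    ; len≥2  = len≥2 P ∘ suc
    ; step≉ε = step≉ε P ∘ suc
    }

  module _ {r} (P : GAPRep G (suc r)) where
    open CommutativeMonoidSolver commutativeMonoid using (solve; _⊜_; _⊕_)

    private
      swap : ∀ a b c → a ∙ (b ∙ c) ≈ b ∙ (a ∙ c)
      swap = solve 3 (λ a b c → a ⊕ (b ⊕ c) ⊜ b ⊕ (a ⊕ c)) refl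

    ∈-uncons : ∀ {x} → ⟦_⟧ P x →
               ∃₂ λ (n : Fin (len P zero)) y → ⟦_⟧ (tailRep P) y × x ≈ toℕ n · step P zero ∙ y
    ∈-uncons (n , x≈) =
      n zero , point (tailRep P) (n ∘ suc) , (n ∘ suc , refl) , trans x≈ (swap _ _ _)

    ∈-cons : ∀ {x y} (n : Fin (len P zero)) → ⟦_⟧ (tailRep P) y → x ≈ toℕ n · step P zero ∙ y → ⟦_⟧ P x
    ∈-cons n (m , y≈) x≈ =
      (λ { zero → n ; (suc i) → m i }) , trans x≈ (trans (∙-congˡ y≈) (swap _ _ _))

  setHead : ∀ {r} (P : GAPRep G (suc r)) → Box P → Fin (len P zero) → Box P
  setHead P n j zero    = j
  setHead P n j (suc i) = n (suc i)

  -- When `i` or `j` is `n zero`, `point` of the updated box unfolds to `point P n`, so the lemma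
  -- serves to move up as well as down in the first direction.
  setHead-+ : ∀ {r} (P : GAPRep G (suc r)) (n : Box P) k (i j : Fin (len P zero)) →
              toℕ j ≡ k + toℕ i → point P (setHead P n j) ≈ k · step P zero ∙ point P (setHead P n i)
  setHead-+ P n k i j j≡k+i rewrite j≡k+i =
    trans (∙-congˡ (∙-congʳ (×-homo-+ (step P zero) k (toℕ i))))
          (solve 4 (λ b d x y → b ⊕ ((d ⊕ x) ⊕ y) ⊜ d ⊕ (b ⊕ (x ⊕ y))) refl _ _ _ _)
    where
    open CommutativeMonoidSolver commutativeMonoid using (solve; _⊜_; _⊕_)
    open MultProperties commutativeMonoid using (×-homo-+)

-- The characteristic of the field.

module FiniteFieldOf {c ℓ : Level} (n f : ℕ) (p-prime : Prime (2 + n))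
                     (F : FiniteField c ℓ ((2 + n) ^ f)) where
  open FiniteField F hiding (zero) renaming (_+_ to _⊞_; _*_ to _⊠_; -_ to ⊟_; _-_ to _⊟_)
  open Inverse enumeration using (to; from; to-cong; from-cong; strictlyInverseˡ; strictlyInverseʳ)
  open MultProperties +-commutativeMonoid renaming (_×_ to _·_)
  open SemiringMult semiring using (×-assoc-*; ×1-homo-*)
  open SumProperties +-commutativeMonoid using (sum; sum-cong-≋; sum-replicate; sum-permute; ∑-distrib-+)
  open GroupProperties +-group using
    ( identityˡ-unique; identityʳ-unique; ∙-cancelˡ; ∙-cancelʳ; //-rightDividesˡ; x∙y⁻¹≈ε⇒x≈y )
  open CommutativeMonoidSolver +-commutativeMonoid using (solve; _⊜_; _⊕_)
  open SetoidReasoning setoid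

  -- Writing p as `2 + n` turns p - 1 into `suc n`, which is used both as the coefficient -1 and as
  -- the length of [0,p-2].
  p q : ℕ
  p = 2 + n
  q = p ^ f

  to-injective : ∀ {x y} → to x ≡ to y → x ≈ y
  to-injective {x} {y} eq =
    trans (sym (strictlyInverseʳ x)) (trans (from-cong eq) (strictlyInverseʳ y))

  _≟_ : Decidable _≈_
  x ≟ y = map′ to-injective to-cong (to x Fin.≟ to y)

  -- Translation by 1 permutes the field, so the sum S of all elements satisfies S = q·1 + S.
  q·1≈0 : q · 1# ≈ 0#
  q·1≈0 = identityˡ-unique (q · 1#) (sum from) (sym (begin
    sum from                                 ≈⟨ sum-permute from π ⟩
    sum (λ i → from (π ⟨$⟩ʳ i))              ≈⟨ sum-cong-≋ (λ i → strictlyInverseʳ (1# ⊞ from i)) ⟩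
    sum (λ i → 1# ⊞ from i)                  ≈⟨ ∑-distrib-+ (replicate q 1#) from ⟩
    sum (replicate q 1#) ⊞ sum from          ≈⟨ +-congʳ (sum-replicate q) ⟩
    q · 1# ⊞ sum from                        ∎))
    where
    fwd bwd : Fin q → Fin q
    fwd i = to (1# ⊞ from i)
    bwd i = to (⊟ 1# ⊞ from i)

    fwd∘bwd : ∀ i → fwd (bwd i) ≡ i
    fwd∘bwd i = ≡.trans (to-cong (begin
      1# ⊞ from (to (⊟ 1# ⊞ from i))  ≈⟨ +-congˡ (strictlyInverseʳ _) ⟩
      1# ⊞ (⊟ 1# ⊞ from i)            ≈⟨ +-assoc _ _ _ ⟨
      (1# ⊞ ⊟ 1#) ⊞ from i            ≈⟨ +-congʳ (-‿inverseʳ 1#) ⟩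
      0# ⊞ from i                     ≈⟨ +-identityˡ _ ⟩
      from i                          ∎)) (strictlyInverseˡ i)

    bwd∘fwd : ∀ i → bwd (fwd i) ≡ i
    bwd∘fwd i = ≡.trans (to-cong (begin
      ⊟ 1# ⊞ from (to (1# ⊞ from i))  ≈⟨ +-congˡ (strictlyInverseʳ _) ⟩
      ⊟ 1# ⊞ (1# ⊞ from i)            ≈⟨ +-assoc _ _ _ ⟨
      (⊟ 1# ⊞ 1#) ⊞ from i            ≈⟨ +-congʳ (-‿inverseˡ 1#) ⟩
      0# ⊞ from i                     ≈⟨ +-identityˡ _ ⟩
      from i                          ∎)) (strictlyInverseˡ i)

    π : Permutation′ q
    π = permutation fwd bwd fwd∘bwd bwd∘fwd

  noZeroDivisors : ∀ x y → x ⊠ y ≈ 0# → x ≈ 0# ⊎ y ≈ 0#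
  noZeroDivisors x y xy≈0 with x ≟ 0#
  ... | yes x≈0 = inj₁ x≈0
  ... | no  x≉0 = let z , xz≈1 = inverse x x≉0 in inj₂ (begin
    y              ≈⟨ *-identityˡ y ⟨
    1# ⊠ y         ≈⟨ *-congʳ xz≈1 ⟨
    (x ⊠ z) ⊠ y    ≈⟨ *-congʳ (*-comm x z) ⟩
    (z ⊠ x) ⊠ y    ≈⟨ *-assoc z x y ⟩
    z ⊠ (x ⊠ y)    ≈⟨ *-congˡ xy≈0 ⟩
    z ⊠ 0#         ≈⟨ zeroʳ z ⟩
    0#             ∎)

  -- Since q·1 is the f-th power of p·1 and there are no zero divisors, it vanishes only if p·1
  -- does.
  p·1≈0 : p · 1# ≈ 0#
  p·1≈0 = power f q·1≈0
    where
    power : ∀ k → (p ^ k) · 1# ≈ 0# → p · 1# ≈ 0#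
    power zero    1·1≈0 = contradiction (trans (sym 1·1≈0) (×-homo-1 1#)) 0≉1
    power (suc k) eq with noZeroDivisors (p · 1#) ((p ^ k) · 1#) (trans (sym (×1-homo-* p (p ^ k))) eq)
    ... | inj₁ p·1≈0   = p·1≈0
    ... | inj₂ pᵏ·1≈0 = power k pᵏ·1≈0

  ·1-⊠ : ∀ m x → m · x ≈ (m · 1#) ⊠ x
  ·1-⊠ m x = trans (×-congʳ m (sym (*-identityˡ x))) (sym (×-assoc-* m 1# x))

  ·-zeroʳ : ∀ m → m · 0# ≈ 0#
  ·-zeroʳ m = trans (·1-⊠ m 0#) (zeroʳ _)

  p·x≈0 : ∀ x → p · x ≈ 0#
  p·x≈0 x = trans (·1-⊠ p x) (trans (*-congʳ p·1≈0) (zeroˡ x))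

  *p·x≈0 : ∀ m x → (m * p) · x ≈ 0#
  *p·x≈0 m x = trans (sym (×-assocˡ x m p)) (trans (×-congʳ m (p·x≈0 x)) (·-zeroʳ m))

  -- Natural numbers modulo p as coefficients.

  infix 4 _≋_
  -- Congruence modulo p; multiples of p on both sides avoid subtraction in ℕ.
  _≋_ : ℕ → ℕ → Set
  a ≋ b = ∃₂ λ i j → a + i * p ≡ b + j * p

  ≋⇒≈ : ∀ {a b} → a ≋ b → ∀ x → a · x ≈ b · x
  ≋⇒≈ {a} {b} (i , j , eq) x = begin
    a · x                ≈⟨ absorb a i ⟨
    (a + i * p) · x      ≡⟨ ≡.cong (_· x) eq ⟩
    (b + j * p) · x      ≈⟨ absorb b j ⟩
    b · x                ∎
    where
    absorb : ∀ a i → (a + i * p) · x ≈ a · x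
    absorb a i = trans (×-homo-+ x a (i * p)) (trans (+-congˡ (*p·x≈0 i x)) (+-identityʳ _))

  ≋-refl : ∀ {a b} → a ≡ b → a ≋ b
  ≋-refl a≡b = 0 , 0 , ≡.cong (_+ 0) a≡b

  ∤⇒invertible : ∀ {a} → ¬ p ∣ a → ∃ λ m → m * a ≋ 1
  ∤⇒invertible {a} p∤a with coprime-Bézout coprime
    where
    coprime : Coprime p a
    coprime (d∣p , d∣a) with prime⇒irreducible p-prime d∣p
    ... | inj₁ d≡1    = d≡1
    ... | inj₂ ≡.refl = contradiction d∣a p∤a
  ... | Bézout.-+ x y eq = y , 0 , x , ≡.trans (ℕ.+-identityʳ _) (≡.sym eq)
  -- Here y·a ≡ -1, so the inverse is -y, written (p - 1)·y.
  ... | Bézout.+- x y eq = suc n * y , x , y * a , ≡.trans (≡.cong (suc n * y * a +_) (≡.sym eq))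
          (+-*-Solver.solve 3 (λ n y a → ((con 1 :+ n) :* y :* a) :+ (con 1 :+ y :* a)
             := con 1 :+ (y :* a) :* (con 2 :+ n)) ≡.refl n y a)
    where open +-*-Solver using (_:+_; _:*_; _:=_; con)

  ∣⇒·≈0 : ∀ {a} → p ∣ a → ∀ x → a · x ≈ 0#
  ∣⇒·≈0 (divides m ≡.refl) x = *p·x≈0 m x

  ·≈0⇒∣ : ∀ {a x} → a · x ≈ 0# → ¬ x ≈ 0# → p ∣ a
  ·≈0⇒∣ {a} {x} ax≈0 x≉0 with p ∣? a
  ... | yes p∣a = p∣a
  ... | no  p∤a = let m , ma≋1 = ∤⇒invertible p∤a in contradiction (begin
    x             ≈⟨ ×-homo-1 x ⟨
    1 · x         ≈⟨ ≋⇒≈ ma≋1 x ⟨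
    (m * a) · x   ≈⟨ ×-assocˡ x m a ⟨
    m · (a · x)   ≈⟨ ×-congʳ m ax≈0 ⟩
    m · 0#        ≈⟨ ·-zeroʳ m ⟩
    0#            ∎) x≉0

  -- Linear algebra over the prime field.

  lc : ∀ {k} → (Fin k → ℕ) → Vector Carrier k → Carrier
  lc c e = sum (λ i → c i · e i)

  Span : ∀ {k} → Vector Carrier k → Carrier → Set ℓ
  Span e x = ∃ λ c → x ≈ lc c e

  -- This recursive form suits bases built by prepending a vector outside the span so far;
  -- `independent⇒∣` recovers the usual one.
  Independent : ∀ {k} → Vector Carrier k → Set ℓ
  Independent {zero}  e = ⊤
  Independent {suc k} e = ¬ Span (tail e) (head e) × Independent (tail e)

  lc-cong : ∀ {k} (c d : Fin k → ℕ) e → (∀ i → c i ≋ d i) → lc c e ≈ lc d e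
  lc-cong c d e c≋d = sum-cong-≋ (λ i → ≋⇒≈ (c≋d i) (e i))

  lc-+ : ∀ {k} (c d : Fin k → ℕ) e → lc (λ i → c i + d i) e ≈ lc c e ⊞ lc d e
  lc-+ c d e = trans (sum-cong-≋ (λ i → ×-homo-+ (e i) (c i) (d i)))
                     (∑-distrib-+ (λ i → c i · e i) (λ i → d i · e i))

  lc-* : ∀ {k} m (c : Fin k → ℕ) e → lc (λ i → m * c i) e ≈ m · lc c e
  lc-* {zero}  m c e = sym (·-zeroʳ m)
  lc-* {suc k} m c e = begin
    (m * head c) · head e ⊞ lc (λ i → m * tail c i) (tail e)
      ≈⟨ +-cong (sym (×-assocˡ (head e) m (head c))) (lc-* m (tail c) (tail e)) ⟩
    m · (head c · head e) ⊞ m · lc (tail c) (tail e)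
      ≈⟨ ×-distrib-+ _ _ m ⟨
    m · lc c e ∎

  lc-∣ : ∀ {k} (c : Fin k → ℕ) e → (∀ i → p ∣ c i) → lc c e ≈ 0#
  lc-∣ {zero}  c e p∣c = refl
  lc-∣ {suc k} c e p∣c =
    trans (+-cong (∣⇒·≈0 (p∣c zero) _) (lc-∣ (tail c) (tail e) (p∣c ∘ suc))) (+-identityˡ 0#)

  -- The coefficient −1 is p − 1 = 1 + n.
  +≈0⇒Span : ∀ {k} {e : Vector Carrier k} {x y} → x ⊞ y ≈ 0# → Span e y → Span e x
  +≈0⇒Span {e = e} {x} {y} x+y≈0 (c , y≈) = (λ i → suc n * c i) , (begin
    x                                ≈⟨ +-identityʳ x ⟨
    x ⊞ 0#                           ≈⟨ +-congˡ (p·x≈0 y) ⟨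
    x ⊞ (y ⊞ suc n · y)              ≈⟨ +-assoc _ _ _ ⟨
    (x ⊞ y) ⊞ suc n · y              ≈⟨ +-congʳ x+y≈0 ⟩
    0# ⊞ suc n · y                   ≈⟨ +-identityˡ _ ⟩
    suc n · y                        ≈⟨ ×-congʳ (suc n) y≈ ⟩
    suc n · lc c e                   ≈⟨ lc-* (suc n) c e ⟨
    lc (λ i → suc n * c i) e         ∎)

  -- A leading coefficient prime to p could be inverted, which would put `head e` in the span of
  -- `tail e`. So its term vanishes, and the rest follows by induction.
  independent⇒∣ : ∀ {k} (e : Vector Carrier k) → Independent e →
                  ∀ c → lc c e ≈ 0# → ∀ i → p ∣ c i
  independent⇒∣ {suc k} e (e₀∉ , ind) c lc≈0 = λ { zero → p∣c₀ ; (suc i) → p∣tail i }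
    where
    p∣c₀ : p ∣ head c
    p∣c₀ with p ∣? head c
    ... | yes p∣ = p∣
    ... | no  p∤ = let m , mc≋1 = ∤⇒invertible p∤ in
      contradiction (+≈0⇒Span {e = tail e} (begin
        head e ⊞ lc (λ i → m * tail c i) (tail e)
          ≈⟨ +-congʳ (trans (sym (×-homo-1 _)) (sym (≋⇒≈ mc≋1 _))) ⟩
        lc (λ i → m * c i) e   ≈⟨ lc-* m c e ⟩
        m · lc c e             ≈⟨ ×-congʳ m lc≈0 ⟩
        m · 0#                 ≈⟨ ·-zeroʳ m ⟩
        0#                     ∎) ((λ i → m * tail c i) , refl)) e₀∉

    p∣tail : ∀ i → p ∣ tail c i
    p∣tail = independent⇒∣ (tail e) ind (tail c) (begin
      lc (tail c) (tail e)                        ≈⟨ +-identityˡ _ ⟨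
      0# ⊞ lc (tail c) (tail e)                   ≈⟨ +-congʳ (∣⇒·≈0 p∣c₀ _) ⟨
      lc c e                                      ≈⟨ lc≈0 ⟩
      0#                                          ∎)

  reduce : ∀ a → toℕ (a mod p) ≋ a
  reduce a = a / p , 0 , ≡.trans (≡.cong (_+ a / p * p) (toℕ-fromℕ< (m%n<n a p)))
                          (≡.trans (≡.sym (m≡m%n+[m/n]*n a p)) (≡.sym (ℕ.+-identityʳ a)))

  -- The hypothesis means a ≡ b. It is symmetric because the two versions add up to (a + b)p, and b
  -- < a would make p divide a - b, which lies strictly between 0 and p.
  ∣a+[p-1]b⇒≡ : (a b : Fin p) → p ∣ toℕ a + suc n * toℕ b → a ≡ b
  ∣a+[p-1]b⇒≡ a b p∣ = toℕ-injective (ℕ.≤-antisym (≤-of a b p∣) (≤-of b a p∣′))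
    where
    open +-*-Solver using (_:+_; _:*_; _:=_; con)

    p∣′ : p ∣ toℕ b + suc n * toℕ a
    p∣′ = ∣m+n∣m⇒∣n (≡.subst (p ∣_) (+-*-Solver.solve 3 (λ n a b →
              (a :+ b) :* (con 2 :+ n) := (a :+ (con 1 :+ n) :* b) :+ (b :+ (con 1 :+ n) :* a))
              ≡.refl n (toℕ a) (toℕ b)) (n∣m*n (toℕ a + toℕ b))) p∣

    ≤-of : (a b : Fin p) → p ∣ toℕ a + suc n * toℕ b → toℕ a ≤ toℕ b
    ≤-of a b p∣ with toℕ b ℕ.<? toℕ a
    ... | no  b≮a = ℕ.≮⇒≥ b≮a
    ... | yes b<a = contradiction (∣m+n∣m⇒∣n (≡.subst (p ∣_) rearranged p∣) (n∣m*n (toℕ b)))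
                      (>⇒∤ {{>-nonZero (ℕ.m<n⇒0<n∸m b<a)}} (ℕ.≤-<-trans (ℕ.m∸n≤m (toℕ a) (toℕ b)) (toℕ<n a)))
      where
      rearranged : toℕ a + suc n * toℕ b ≡ toℕ b * p + (toℕ a ∸ toℕ b)
      rearranged = ≡.trans (≡.cong (_+ suc n * toℕ b) (≡.sym (ℕ.m∸n+n≡m (ℕ.<⇒≤ b<a))))
        (+-*-Solver.solve 3 (λ n b d → (d :+ b) :+ (con 1 :+ n) :* b := b :* (con 2 :+ n) :+ d)
           ≡.refl n (toℕ b) (toℕ a ∸ toℕ b))

  -- The base-p digits of the index are the coefficients, so a span can be searched and counted
  -- through p^k indices.
  decode : ∀ {k} → Vector Carrier k → Fin (p ^ k) → Carrier
  decode e i = lc (toℕ ∘ finToFun i) e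

  Span⇒decode : ∀ {k} {e : Vector Carrier k} {x} → Span e x → ∃ λ i → x ≈ decode e i
  Span⇒decode {e = e} (c , x≈) = funToFin (λ i → c i mod p) , trans x≈ (lc-cong c _ e (λ i →
    ≡.subst (λ d → c i ≋ toℕ d) (≡.sym (finToFun-funToFin _ i)) (≋-sym (reduce (c i)))))
    where
    ≋-sym : ∀ {a b} → a ≋ b → b ≋ a
    ≋-sym (i , j , eq) = j , i , ≡.sym eq

  decode-injective : ∀ {k} (e : Vector Carrier k) → Independent e →
                     ∀ {i j} → decode e i ≈ decode e j → i ≡ j
  decode-injective {k} e ind {i} {j} eq =
    ≡.trans (≡.sym (funToFin-finToFin {k} i)) (≡.trans (funToFin-cong (λ l →
      ∣a+[p-1]b⇒≡ (finToFun i l) (finToFun j l) 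
        (independent⇒∣ e ind (λ l → a l + suc n * b l) difference≈0 l)))
      (funToFin-finToFin {k} j))
    where
    a b : Fin k → ℕ
    a = toℕ ∘ finToFun i
    b = toℕ ∘ finToFun j

    difference≈0 : lc (λ l → a l + suc n * b l) e ≈ 0#
    difference≈0 = begin
      lc (λ l → a l + suc n * b l) e            ≈⟨ lc-+ a (λ l → suc n * b l) e ⟩
      lc a e ⊞ lc (λ l → suc n * b l) e         ≈⟨ +-cong eq (lc-* (suc n) b e) ⟩
      lc b e ⊞ suc n · lc b e                   ≈⟨ p·x≈0 _ ⟩
      0#                                        ∎

  Span? : ∀ {k} (e : Vector Carrier k) x → Dec (Span e x)
  Span? e x = map′ (λ (i , x≈) → toℕ ∘ finToFun i , x≈) (Span⇒decode {e = e})
                   (any? (λ i → x ≟ decode e i))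

  -- By counting: k vectors span at most p^k elements, fewer than q.
  ∃-∉Span : ∀ {k} (e : Vector Carrier k) → k < f → ∃ λ v → ¬ Span e v
  ∃-∉Span e k<f =
    let y , y∉ = ∃-not-in-image (ℕ.^-monoʳ-< p (s<s z<s) k<f) (to ∘ decode e)
    in from y , λ v∈ → let i , v≈ = Span⇒decode {e = e} v∈ in
         y∉ i (≡.trans (to-cong (sym v≈)) (strictlyInverseˡ y))

  ∃-independent : ∀ k → k ≤ f → ∃ λ (e : Vector Carrier k) → Independent e
  ∃-independent zero    _   = [] , tt
  ∃-independent (suc k) k<f =
    let e , ind = ∃-independent k (ℕ.<⇒≤ k<f)
        v , v∉  = ∃-∉Span e k<f
    in v ∷ e , v∉ , ind

  -- Prepending a vector outside the span would give p^(k+1) > q distinct combinations.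
  independent⇒spanning : ∀ {k} → f ≤ k → (e : Vector Carrier k) → Independent e → ∀ x → Span e x
  independent⇒spanning {k} f≤k e ind x with Span? e x
  ... | yes x∈ = x∈
  ... | no  x∉ = contradiction
    (injective⇒≤ {f = to ∘ decode (x ∷ e)} (decode-injective (x ∷ e) (x∉ , ind) ∘ to-injective))
    (ℕ.<⇒≱ (ℕ.^-monoʳ-< p (s<s z<s) (s<s f≤k)))

  -- Obstructions to representing the units.

  open GAPRep

  𝔽⁺ : AbelianGroup c ℓ
  𝔽⁺ = +-abelianGroup

  -- A singleton would identify 1 with a unit `v` outside the span of 1.
  rank0≠units : 1 < f → (P : GAPRep 𝔽⁺ 0) → ¬ (Nonzero ≐ ⟦_⟧ P)
  rank0≠units 1<f P (⊆P , _) = v∉ ((λ _ → 1) , (begin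
    v             ≈⟨ proj₂ (⊆P v≉0) ⟩
    base P ⊞ 0#   ≈⟨ proj₂ (⊆P (0≉1 ∘ sym)) ⟨
    1#            ≈⟨ ×-homo-1 1# ⟨
    1 · 1#        ≈⟨ +-identityʳ _ ⟨
    1 · 1# ⊞ 0#   ∎))
    where
    v : Carrier
    v = proj₁ (∃-∉Span (1# ∷ []) 1<f)

    v∉ : ¬ Span (1# ∷ []) v
    v∉ = proj₂ (∃-∉Span (1# ∷ []) 1<f)

    v≉0 : ¬ v ≈ 0#
    v≉0 v≈0 = v∉ ((λ _ → 0) , trans v≈0 (sym (+-identityʳ 0#)))

  module _ {r} (P : GAPRep 𝔽⁺ (suc r)) (units≐P : Nonzero ≐ ⟦_⟧ P) where
    private
      L : ℕ
      L = len P zero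

      d : Carrier
      d = step P zero

      point≉0 : ∀ b → ¬ point P b ≈ 0#
      point≉0 b = proj₂ units≐P (b , refl)

      module _ (b : Box P) where
        predecessor : ∀ {j} → toℕ (b zero) ≡ suc j → Fin L
        predecessor {j} eq = fromℕ< (ℕ.<-trans (ℕ.n<1+n j) (≡.subst (_< L) eq (toℕ<n (b zero))))

        toℕ-predecessor : ∀ {j} (eq : toℕ (b zero) ≡ suc j) → toℕ (predecessor eq) ≡ j
        toℕ-predecessor eq = toℕ-fromℕ< _

        point-predecessor : ∀ {j} (eq : toℕ (b zero) ≡ suc j) →
                            point P b ≈ d ⊞ point P (setHead 𝔽⁺ P b (predecessor eq))
        point-predecessor {j} eq = trans
          (setHead-+ 𝔽⁺ P b 1 (predecessor eq) (b zero)
            (≡.trans eq (≡.cong suc (≡.sym (toℕ-predecessor eq)))))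
          (+-congʳ (×-homo-1 d))

    -- If L ≥ p, the line through the parameters of d in the first direction is a coset of ⟨d⟩
    -- containing d, hence contains 0.
    length<p : L < p
    length<p = ℕ.≰⇒> ¬p≤L
      where
      d∈P : ⟦_⟧ P d
      d∈P = proj₁ units≐P (step≉ε P zero)

      b : Box P
      b = proj₁ d∈P

      ¬p≤L : ¬ p ≤ L
      ¬p≤L p≤L with toℕ (b zero) in eq
      ... | suc j = point≉0 (setHead 𝔽⁺ P b (predecessor b eq))
        (identityʳ-unique d _ (trans (sym (point-predecessor b eq)) (sym (proj₂ d∈P))))
      ... | zero  = point≉0 (setHead 𝔽⁺ P b last) (begin
        point P (setHead 𝔽⁺ P b last)    ≈⟨ setHead-+ 𝔽⁺ P b (suc n) (b zero) last last≡ ⟩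
        suc n · d ⊞ point P b            ≈⟨ +-congˡ (proj₂ d∈P) ⟨
        suc n · d ⊞ d                    ≈⟨ +-comm _ d ⟩
        p · d                            ≈⟨ p·x≈0 d ⟩
        0#                               ∎)
        where
        last : Fin L
        last = fromℕ< p≤L

        last≡ : toℕ last ≡ suc n + toℕ (b zero)
        last≡ = ≡.trans (toℕ-fromℕ< p≤L) (≡.trans (≡.sym (ℕ.+-identityʳ _)) (≡.cong (suc n +_) (≡.sym eq)))

    coset-avoiding-0⇒¬proper : ∀ x → (∀ k → ¬ k · d ⊞ x ≈ 0#) → ¬ Proper P
    coset-avoiding-0⇒¬proper x avoids proper = L∤p L∣p
      where
      box : ∀ k → Box P
      box k = proj₁ (proj₁ units≐P (avoids k))

      point-box : ∀ k → k · d ⊞ x ≈ point P (box k)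
      point-box k = proj₂ (proj₁ units≐P (avoids k))

      first : ℕ → ℕ
      first k = toℕ (box k zero)

      point-suc : ∀ k → point P (box (suc k)) ≈ d ⊞ point P (box k)
      point-suc k = trans (sym (point-box (suc k))) (trans (+-assoc d _ x) (+-congˡ (point-box k)))

      -- If the old coordinate can be raised, the raised box represents the new point and properness
      -- identifies the boxes. Otherwise a positive new coordinate, lowered by 1, gives a box for
      -- the old point; by properness the new coordinate is then the successor of the old one, which
      -- was excluded.
      first-suc : ∀ k → first (suc k) ≡ suc (first k) ⊎ (first (suc k) ≡ 0 × suc (first k) ≡ L)
      first-suc k with suc (first k) ℕ.<? L
      ... | yes lt = inj₁ (≡.trans (≡.cong toℕ (proper (box (suc k)) (setHead 𝔽⁺ P (box k) next) (begin
          point P (box (suc k))                   ≈⟨ point-suc k ⟩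
          d ⊞ point P (box k)                     ≈⟨ +-congʳ (×-homo-1 d) ⟨
          1 · d ⊞ point P (box k)
            ≈⟨ setHead-+ 𝔽⁺ P (box k) 1 (box k zero) next (toℕ-fromℕ< lt) ⟨
          point P (setHead 𝔽⁺ P (box k) next)     ∎) zero)) (toℕ-fromℕ< lt))
        where
        next : Fin L
        next = fromℕ< lt
      ... | no ≮L with first (suc k) in eq
      ...   | zero  = inj₂ (≡.refl , ℕ.≤-antisym (toℕ<n (box k zero)) (ℕ.≮⇒≥ ≮L))
      ...   | suc j = contradiction
        (≡.subst (_< L) (≡.trans eq (≡.cong suc j≡first)) (toℕ<n (box (suc k) zero))) ≮L
        where
        j≡first : j ≡ first k
        j≡first = ≡.trans (≡.sym (toℕ-predecessor (box (suc k)) eq))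
          (≡.cong toℕ (proper (setHead 𝔽⁺ P (box (suc k)) (predecessor (box (suc k)) eq)) (box k)
            (∙-cancelˡ d (point P (setHead 𝔽⁺ P (box (suc k)) (predecessor (box (suc k)) eq)))
              (point P (box k)) (trans (sym (point-predecessor (box (suc k)) eq)) (point-suc k))) zero))

      -- `t` counts the wraps from L - 1 to 0.
      first-mod : ∀ k → ∃ λ t → k + first 0 ≡ t * L + first k
      first-mod zero    = 0 , ≡.refl
      first-mod (suc k) with first-mod k | first-suc k
      ... | t , eq | inj₁ eq′ =
        t , ≡.trans (≡.cong suc eq) (≡.trans (≡.sym (ℕ.+-suc (t * L) (first k)))
              (≡.cong (t * L +_) (≡.sym eq′)))
      ... | t , eq | inj₂ (eq₀ , eqL) =
        suc t , ≡.trans (≡.cong suc eq) (≡.trans (≡.sym (ℕ.+-suc (t * L) (first k)))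
                 (≡.trans (≡.cong (t * L +_) eqL) (≡.trans (ℕ.+-comm (t * L) L)
                 (≡.sym (≡.trans (≡.cong (suc t * L +_) eq₀) (ℕ.+-identityʳ _))))))

      -- Both boxes represent x, because p·d vanishes.
      first-p : first p ≡ first 0
      first-p = ≡.cong toℕ (proper (box p) (box 0) (begin
        point P (box p)    ≈⟨ point-box p ⟨
        p · d ⊞ x          ≈⟨ +-congʳ (p·x≈0 d) ⟩
        0# ⊞ x             ≈⟨ point-box 0 ⟩
        point P (box 0)    ∎) zero)

      L∣p : L ∣ p
      L∣p = let t , eq = first-mod p in
        divides t (ℕ.+-cancelʳ-≡ (first 0) p (t * L) (≡.trans eq (≡.cong (t * L +_) first-p)))

      L∤p : ¬ L ∣ p
      L∤p L∣p with prime⇒irreducible p-prime L∣p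
      ... | inj₁ L≡1 = ℕ.<-irrefl (≡.sym L≡1) (len≥2 P zero)
      ... | inj₂ L≡p = ℕ.<-irrefl L≡p length<p

    -- Some v lies outside the multiples of d, and its coset misses 0.
    units≐P⇒¬proper : 1 < f → ¬ Proper P
    units≐P⇒¬proper 1<f = let v , v∉ = ∃-∉Span (d ∷ []) 1<f in
      coset-avoiding-0⇒¬proper v λ k kd+v≈0 → v∉ (+≈0⇒Span {e = d ∷ []} (trans (+-comm v (k · d)) kd+v≈0)
        ((λ _ → k) , sym (+-identityʳ (k · d))))

  units-not-properGAP : 1 < f → ¬ IsProperGAP 𝔽⁺ Nonzero
  units-not-properGAP 1<f (zero  , P , units≐P , _)      = rank0≠units 1<f P units≐P
  units-not-properGAP 1<f (suc r , P , units≐P , proper) = units≐P⇒¬proper P units≐P 1<f proper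

  -- The prime field.

  suc·1≉0 : ∀ i → i < suc n → ¬ suc i · 1# ≈ 0#
  suc·1≉0 i i<1+n eq = >⇒∤ (s<s i<1+n) (·≈0⇒∣ eq (0≉1 ∘ sym))

  -- `suc (toℕ i) · 1#` unfolds to 1 + i·1, so the right side already is a progression with first
  -- term and difference 1 and p - 1 terms.
  units-AP : f ≡ 1 → Nonzero ≐ (λ x → Σ (Fin (suc n)) λ i → x ≈ suc (toℕ i) · 1#)
  units-AP f≡1 = fwd , λ (i , x≈) x≈0 → suc·1≉0 (toℕ i) (toℕ<n i) (trans (sym x≈) x≈0)
    where
    residue : ∀ {x} → Nonzero x → (a : Fin p) → x ≈ toℕ a · 1# →
              Σ (Fin (suc n)) λ i → x ≈ suc (toℕ i) · 1#
    residue x≉0 zero    x≈0 = contradiction x≈0 x≉0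
    residue x≉0 (suc i) x≈  = i , x≈

    fwd : ∀ {x} → Nonzero x → Σ (Fin (suc n)) λ i → x ≈ suc (toℕ i) · 1#
    fwd {x} x≉0 =
      let a , x≈ = independent⇒spanning (ℕ.≤-reflexive f≡1) (1# ∷ [])
                     ((λ (_ , 1≈0) → 0≉1 (sym 1≈0)) , tt) x
      in residue x≉0 (a zero mod p)
           (trans x≈ (trans (+-identityʳ (a zero · 1#)) (sym (≋⇒≈ (reduce (a zero)) 1#))))

  -- First and last vectors of an independent list.

  0∈Span : ∀ {k} (e : Vector Carrier k) → Span e 0#
  0∈Span e = (λ _ → 0) , sym (lc-∣ (λ _ → 0) e (λ _ → p ∣0))

  head∈Span : ∀ {k} (e : Vector Carrier (suc k)) → Span e (head e)
  head∈Span e = let c , 0≈ = 0∈Span (tail e) in (1 ∷ c) , (begin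
    head e                          ≈⟨ ×-homo-1 (head e) ⟨
    1 · head e                      ≈⟨ +-identityʳ _ ⟨
    1 · head e ⊞ 0#                 ≈⟨ +-congˡ 0≈ ⟩
    1 · head e ⊞ lc c (tail e)      ∎)

  independent⇒head≉0 : ∀ {k} (e : Vector Carrier (suc k)) → Independent e → ¬ head e ≈ 0#
  independent⇒head≉0 e (e₀∉ , _) e₀≈0 = let c , 0≈ = 0∈Span (tail e) in e₀∉ (c , trans e₀≈0 0≈)

  -- The last vector of `e ∷ es`, found by the recursion that `chain` follows; it is e_k in the
  -- closing step e_k - e₀.
  lastFrom : ∀ {k} → Carrier → Vector Carrier k → Carrier
  lastFrom {zero}  e es = e
  lastFrom {suc k} e es = lastFrom (head es) (tail es)

  lastFrom∈Span : ∀ {k} e (es : Vector Carrier k) → Span (e ∷ es) (lastFrom e es)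
  lastFrom∈Span {zero}  e es = head∈Span (e ∷ es)
  lastFrom∈Span {suc k} e es =
    let c , eq = lastFrom∈Span (head es) (tail es) in (0 ∷ c) , trans eq (sym (+-identityˡ (lc c es)))

  -- Runs of bits.

  flip : Fin 2 → Fin 2
  flip zero       = suc zero
  flip (suc zero) = zero

  flip-involutive : ∀ s → flip (flip s) ≡ s
  flip-involutive zero       = ≡.refl
  flip-involutive (suc zero) = ≡.refl

  -- The coefficient a of eᵢ is compatible with the bits s = zᵢ₋₁ and t = zᵢ.
  Step : Fin 2 → ℕ → Fin 2 → Set
  Step s a t = ∃ λ (i : Fin (suc n)) → toℕ i + (toℕ s + toℕ t) ≋ a

  -- A choice of bits from z₀ = `s` to z_k = `t` compatible with the coefficients of e₁, ..., e_k.
  Run : ∀ {k} → Fin 2 → (Fin k → ℕ) → Fin 2 → Set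
  Run {zero}  s c t = s ≡ t
  Run {suc k} s c t = ∃ λ u → Step s (c zero) u × Run u (tail c) t

  p∤suc : (i : Fin (suc n)) → ¬ p ∣ suc (toℕ i)
  p∤suc i = >⇒∤ (s<s (toℕ<n i))

  -- Unequal bits would give the coefficient i + 1, which lies in [1,p-1].
  step-∣ : ∀ {s a t} → p ∣ a → Step s a t → s ≡ t
  step-∣ {s} {a} {t} p∣a (i , x , y , eq) =
    bits s t (∣m+n∣m⇒∣n (≡.subst (p ∣_) (≡.trans (≡.sym eq) (ℕ.+-comm _ (x * p)))
      (∣m∣n⇒∣m+n p∣a (n∣m*n y))) (n∣m*n x))
    where
    bits : ∀ s t → p ∣ toℕ i + (toℕ s + toℕ t) → s ≡ t
    bits zero       zero       _  = ≡.refl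
    bits (suc zero) (suc zero) _  = ≡.refl
    bits zero       (suc zero) p∣ = contradiction (≡.subst (p ∣_) (ℕ.+-comm (toℕ i) 1) p∣) (p∤suc i)
    bits (suc zero) zero       p∣ = contradiction (≡.subst (p ∣_) (ℕ.+-comm (toℕ i) 1) p∣) (p∤suc i)

  run-∣ : ∀ {k s t} (c : Fin k → ℕ) → (∀ i → p ∣ c i) → Run s c t → s ≡ t
  run-∣ {zero}  c p∣c s≡t = s≡t
  run-∣ {suc k} c p∣c (u , step , run) =
    ≡.trans (step-∣ (p∣c zero) step) (run-∣ (tail c) (λ i → p∣c (suc i)) run)

  module _ (1≤n : 1 ≤ n) where
    private
      -- Oddness of p enters as `1 ≤ n`, which puts 1 in [0,p-2].
      one : Fin (suc n)
      one = fromℕ< (s<s 1≤n)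

    step-cases : (a : Fin p) →
      (a ≡ zero × (∀ s → Step s (toℕ a) s)) ⊎
      ((∀ s → Step s (toℕ a) (flip s)) × ∃ λ s → Step s (toℕ a) s)
    step-cases zero = inj₁ (≡.refl , stay)
      where
      stay : ∀ s → Step s 0 s
      stay zero       = zero , ≋-refl ≡.refl
      -- The parameter p - 2 and two bits 1 add up to p.
      stay (suc zero) = Fin.fromℕ n , 0 , 1 , 
        ≡.trans (ℕ.+-identityʳ _) (≡.trans (≡.cong (_+ 2) (Fin.toℕ-fromℕ n))
          (≡.trans (ℕ.+-comm n 2) (≡.sym (ℕ.+-identityʳ p))))
    step-cases (suc a) = inj₂ (swap , stay a)
      where
      swap : ∀ s → Step s (suc (toℕ a)) (flip s)
      swap zero       = a , ≋-refl (ℕ.+-comm (toℕ a) 1)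
      swap (suc zero) = a , ≋-refl (ℕ.+-comm (toℕ a) 1)

      stay : (a : Fin (suc n)) → ∃ λ s → Step s (suc (toℕ a)) s
      -- The coefficient 1 is reached as 1 + 0 + 0; a larger one uses two bits 1 and a parameter at
      -- most p - 3.
      stay zero    = zero , one , ≋-refl (≡.trans (ℕ.+-identityʳ _) (toℕ-fromℕ< (s<s 1≤n)))
      stay (suc a) = suc zero , Fin.inject₁ a ,
        ≋-refl (≡.trans (≡.cong (_+ 2) (Fin.toℕ-inject₁ a)) (ℕ.+-comm (toℕ a) 2))

    -- Flip the bit exactly at the nonzero coefficients: the parity of their number decides whether
    -- the run returns to its starting bit.
    run-parity : ∀ {k} (c : Fin k → Fin p) →
                 (∀ s → Run s (toℕ ∘ c) s) ⊎ (∀ s → Run s (toℕ ∘ c) (flip s))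
    run-parity {zero}  c = inj₁ λ s → ≡.refl
    run-parity {suc k} c with step-cases (c zero) | run-parity (tail c)
    ... | inj₁ (_ , stay) | inj₁ same     = inj₁ λ s → s , stay s , same s
    ... | inj₁ (_ , stay) | inj₂ opposite = inj₂ λ s → s , stay s , opposite s
    ... | inj₂ (swap , _) | inj₁ same     = inj₂ λ s → flip s , swap s , same (flip s)
    ... | inj₂ (swap , _) | inj₂ opposite = inj₁ λ s →
      flip s , swap s , ≡.subst (Run (flip s) (toℕ ∘ tail c)) (flip-involutive s) (opposite (flip s))

    -- If the number of nonzero coefficients is even, keeping the bit at the first of them corrects
    -- the parity. This is possible from one starting bit at least, hence the existential.
    run-flip : ∀ {k} (c : Fin k → Fin p) i → c i ≢ zero → ∃ λ s → Run s (toℕ ∘ c) (flip s)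
    run-flip {suc k} c i cᵢ≢0 with step-cases (c zero) | run-parity (tail c)
    ... | inj₂ (swap , _)        | inj₁ same     = zero , flip zero , swap zero , same (flip zero)
    ... | inj₂ (_ , s , stay)    | inj₂ opposite = s , s , stay , opposite s
    run-flip {suc k} c zero    cᵢ≢0 | inj₁ (c₀≡0 , _) | _ = contradiction c₀≡0 cᵢ≢0
    run-flip {suc k} c (suc i) cᵢ≢0 | inj₁ (_ , stay) | _ =
      let s , run = run-flip (tail c) i cᵢ≢0 in s , s , stay s , run

    -- The coefficient of e₀ is (i + 1) + s - t with i + 1 in [1,p-1]. The value 0 therefore calls
    -- for s ≠ t, hence for `run-flip`; for other values `run-parity` suffices.
    closed-run : ∀ {k} (a : Fin p) (c : Fin k → Fin p) → a ≢ zero ⊎ (∃ λ i → c i ≢ zero) →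
      ∃ λ (i : Fin (suc n)) → ∃₂ λ s t → Run s (toℕ ∘ c) t × toℕ a + toℕ t ≋ suc (toℕ i) + toℕ s
    closed-run zero c (inj₁ a≢0) = contradiction ≡.refl a≢0
    closed-run zero c (inj₂ (i , cᵢ≢0)) with run-flip c i cᵢ≢0
    ... | zero     , run = zero , zero , suc zero , run , ≋-refl ≡.refl
    ... | suc zero , run = Fin.fromℕ n , suc zero , zero , run , 1 , 0 , 
      ≡.trans (ℕ.+-identityʳ p) (≡.trans (ℕ.+-comm 1 (suc n))
        (≡.trans (≡.cong (λ m → suc m + 1) (≡.sym (Fin.toℕ-fromℕ n))) (≡.sym (ℕ.+-identityʳ _))))
    closed-run (suc a) c _ with run-parity c
    ... | inj₁ same = a , zero , zero , same zero , ≋-refl ≡.refl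
    -- With opposite ends, 1 is obtained as 2 + 0 - 1, since i + 1 cannot be 0. From 2 on, s = 1 and
    -- t = 0 keep i in range.
    closed-run (suc zero) c _ | inj₂ opposite =
      one , zero , suc zero , opposite zero ,
      ≋-refl (≡.cong suc (≡.sym (≡.trans (ℕ.+-identityʳ _) (toℕ-fromℕ< (s<s 1≤n)))))
    closed-run (suc (suc a)) c _ | inj₂ opposite =
      Fin.inject₁ a , suc zero , zero , opposite (suc zero) ,
      ≋-refl (≡.cong suc (≡.trans (ℕ.+-identityʳ _) (≡.trans (ℕ.+-comm 1 (toℕ a))
        (≡.cong (_+ 1) (≡.sym (Fin.toℕ-inject₁ a))))))

    -- The chain of links as a representation.

    module _ (e₀ : Carrier) where
      -- e₀ and the terms after [0,p−2]e, where es are the basis vectors after e.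
      chain : ∀ {k} e (es : Vector Carrier k) → Independent (e ∷ es) → ¬ lastFrom e es ⊟ e₀ ≈ 0# →
              GAPRep 𝔽⁺ (1 + k * 2)
      chain {zero}  e es ind      closes = consRep 𝔽⁺ 2 (e ⊟ e₀) ℕ.≤-refl closes (pointRep 𝔽⁺ e₀)
      chain {suc k} e es ind closes =
        consRep 𝔽⁺ 2 (e ⊞ head es) ℕ.≤-refl (λ eq → proj₁ ind (+≈0⇒Span {e = es} eq (head∈Span es)))
        (consRep 𝔽⁺ (suc n) (head es) (s≤s 1≤n) (independent⇒head≉0 es (proj₂ ind))
        (chain (head es) (tail es) (proj₂ ind) closes))

      chain-end : ∀ s e → (s · (e ⊟ e₀) ⊞ (e₀ ⊞ 0#)) ⊞ s · e₀ ≈ e₀ ⊞ (s · e ⊞ 0#)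
      chain-end s e = begin
        (s · (e ⊟ e₀) ⊞ (e₀ ⊞ 0#)) ⊞ s · e₀
          ≈⟨ solve 4 (λ a b c z → (a ⊕ (b ⊕ z)) ⊕ c ⊜ b ⊕ ((a ⊕ c) ⊕ z)) refl
               (s · (e ⊟ e₀)) e₀ (s · e₀) 0# ⟩
        e₀ ⊞ ((s · (e ⊟ e₀) ⊞ s · e₀) ⊞ 0#)
          ≈⟨ +-congˡ (+-congʳ (×-distrib-+ (e ⊟ e₀) e₀ s)) ⟨
        e₀ ⊞ (s · (e ⊟ e₀ ⊞ e₀) ⊞ 0#)
          ≈⟨ +-congˡ (+-congʳ (×-congʳ s (//-rightDividesˡ e₀ e))) ⟩
        e₀ ⊞ (s · e ⊞ 0#) ∎

      -- Induction step for both directions: the coefficient of e′ collects its parameter i and the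
      -- two adjacent bits.
      chain-link : ∀ s u i e e′ {y z l} → y ⊞ z ≈ e₀ ⊞ (u · e′ ⊞ l) →
        (s · (e ⊞ e′) ⊞ (i · e′ ⊞ y)) ⊞ z ≈ e₀ ⊞ (s · e ⊞ ((i + (s + u)) · e′ ⊞ l))
      chain-link s u i e e′ {y} {z} {l} eq = begin
        (s · (e ⊞ e′) ⊞ (i · e′ ⊞ y)) ⊞ z
          ≈⟨ +-congʳ (+-congʳ (×-distrib-+ e e′ s)) ⟩
        ((s · e ⊞ s · e′) ⊞ (i · e′ ⊞ y)) ⊞ z
          ≈⟨ solve 5 (λ a b c y z → ((a ⊕ b) ⊕ (c ⊕ y)) ⊕ z ⊜ (a ⊕ (c ⊕ b)) ⊕ (y ⊕ z)) refl
               (s · e) (s · e′) (i · e′) y z ⟩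
        (s · e ⊞ (i · e′ ⊞ s · e′)) ⊞ (y ⊞ z)
          ≈⟨ +-congˡ eq ⟩
        (s · e ⊞ (i · e′ ⊞ s · e′)) ⊞ (e₀ ⊞ (u · e′ ⊞ l))
          ≈⟨ solve 6 (λ a c b o d l → (a ⊕ (c ⊕ b)) ⊕ (o ⊕ (d ⊕ l)) ⊜ o ⊕ (a ⊕ ((c ⊕ (b ⊕ d)) ⊕ l))) refl
               (s · e) (i · e′) (s · e′) e₀ (u · e′) l ⟩
        e₀ ⊞ (s · e ⊞ ((i · e′ ⊞ (s · e′ ⊞ u · e′)) ⊞ l))
          ≈⟨ +-congˡ (+-congˡ (+-congʳ (trans (×-homo-+ e′ i (s + u)) (+-congˡ (×-homo-+ e′ s u))))) ⟨
        e₀ ⊞ (s · e ⊞ ((i + (s + u)) · e′ ⊞ l)) ∎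

      -- The term −t·e₀ of the last link is moved to the left, so that all coefficients are in ℕ.
      chain⁻ : ∀ {k} e (es : Vector Carrier k) ind closes {x} → ⟦_⟧ (chain e es ind closes) x →
        ∃₂ λ s t → ∃ λ c → Run s c t × x ⊞ toℕ t · e₀ ≈ e₀ ⊞ (toℕ s · e ⊞ lc c es)
      chain⁻ {zero} e es ind closes x∈ =
        let s , y , (_ , y≈) , x≈ = ∈-uncons 𝔽⁺ (chain e es ind closes) x∈
        in s , s , (λ ()) , ≡.refl , trans (+-congʳ (trans x≈ (+-congˡ y≈))) (chain-end (toℕ s) e)
      chain⁻ {suc k} e es ind closes x∈ =
        let P = chain e es ind closes
            s , y , y∈ , x≈ = ∈-uncons 𝔽⁺ P x∈
            i , z , z∈ , y≈ = ∈-uncons 𝔽⁺ (tailRep 𝔽⁺ P) y∈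
            u , t , c , run , eq = chain⁻ (head es) (tail es) (proj₂ ind) closes z∈
        in s , t , (toℕ i + (toℕ s + toℕ u) ∷ c) , (u , (i , ≋-refl ≡.refl) , run) ,
           trans (+-congʳ (trans x≈ (+-congˡ y≈))) (chain-link (toℕ s) (toℕ u) (toℕ i) e (head es) eq)

      -- Converse of `chain⁻`: the parameters are those recorded in the run.
      chain⁺ : ∀ {k} e (es : Vector Carrier k) ind closes s t c → Run s c t →
        ∃ λ x → ⟦_⟧ (chain e es ind closes) x × x ⊞ toℕ t · e₀ ≈ e₀ ⊞ (toℕ s · e ⊞ lc c es)
      chain⁺ {zero} e es ind closes s .s c ≡.refl =
        toℕ s · (e ⊟ e₀) ⊞ (e₀ ⊞ 0#) ,
        ∈-cons 𝔽⁺ (chain e es ind closes) s ((λ ()) , refl) refl ,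
        chain-end (toℕ s) e
      chain⁺ {suc k} e es ind closes s t c (u , (i , i+s+u≋c₀) , run) =
        let P = chain e es ind closes
            y , y∈ , eq = chain⁺ (head es) (tail es) (proj₂ ind) closes u t (tail c) run
        in toℕ s · (e ⊞ head es) ⊞ (toℕ i · head es ⊞ y) ,
           ∈-cons 𝔽⁺ P s (∈-cons 𝔽⁺ (tailRep 𝔽⁺ P) i y∈ refl) refl ,
           trans (chain-link (toℕ s) (toℕ u) (toℕ i) e (head es) eq)
                 (+-congˡ (+-congˡ (+-congʳ (≋⇒≈ i+s+u≋c₀ (head es)))))

    -- Closing the chain to a cycle.

    module _ {k} (e : Vector Carrier (2 + k)) (ind : Independent e) where
      private
        e₀ : Carrier
        e₀ = head e

        closes : ¬ lastFrom e₀ (tail e) ⊟ e₀ ≈ 0#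
        closes eq =
          -- If the last vector were e₀, then e₀ would lie in the span of the later vectors.
          let c , last≈ = lastFrom∈Span (head (tail e)) (tail (tail e))
          in proj₁ ind (c , trans (sym (x∙y⁻¹≈ε⇒x≈y (lastFrom e₀ (tail e)) e₀ eq)) last≈)

      -- Each of the 2 + k basis vectors contributes one progression and one bit, whence the rank.
      cycle : GAPRep 𝔽⁺ (2 + (1 + k) * 2)
      cycle = consRep 𝔽⁺ (suc n) e₀ (s≤s 1≤n) (independent⇒head≉0 e ind) (chain e₀ e₀ (tail e) ind closes)

      private
        -- The coefficient of e₀ gathers i, the 1 of the base point and the bit s.
        cycle-sum : ∀ i s {y z l} → y ⊞ z ≈ e₀ ⊞ (s · e₀ ⊞ l) → (i · e₀ ⊞ y) ⊞ z ≈ (suc i + s) · e₀ ⊞ l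
        cycle-sum i s {y} {z} {l} eq = begin
          (i · e₀ ⊞ y) ⊞ z               ≈⟨ +-assoc _ y z ⟩
          i · e₀ ⊞ (y ⊞ z)               ≈⟨ +-congˡ eq ⟩
          i · e₀ ⊞ (e₀ ⊞ (s · e₀ ⊞ l))
            ≈⟨ solve 4 (λ a b c l → a ⊕ (b ⊕ (c ⊕ l)) ⊜ ((b ⊕ a) ⊕ c) ⊕ l) refl (i · e₀) e₀ (s · e₀) l ⟩
          (suc i · e₀ ⊞ s · e₀) ⊞ l      ≈⟨ +-congʳ (×-homo-+ e₀ (suc i) s) ⟨
          (suc i + s) · e₀ ⊞ l           ∎

        cycle-sum≉0 : ∀ (i : Fin (suc n)) s t y c → Run s c t →
          y ⊞ toℕ t · e₀ ≈ e₀ ⊞ (toℕ s · e₀ ⊞ lc c (tail e)) → ¬ toℕ i · e₀ ⊞ y ≈ 0#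
        cycle-sum≉0 i s t y c run eq sum≈0 =
          p∤suc i (p∣suc s t (run-∣ c (λ j → p∣ (suc j)) run) (p∣ zero))
          where
          a : ℕ
          a = suc (toℕ i) + toℕ s

          -- The -t·e₀ of the closing step is entered as (p - 1)t, which the t·e₀ of the hypothesis
          -- completes to a multiple of p.
          lc≈0 : lc ((a + suc n * toℕ t) ∷ c) e ≈ 0#
          lc≈0 = begin
            (a + suc n * toℕ t) · e₀ ⊞ lc c (tail e)
              ≈⟨ +-congʳ (trans (×-homo-+ e₀ a (suc n * toℕ t))
                   (+-congˡ (sym (×-assocˡ e₀ (suc n) (toℕ t))))) ⟩
            (a · e₀ ⊞ suc n · (toℕ t · e₀)) ⊞ lc c (tail e)
              ≈⟨ solve 3 (λ a b l → (a ⊕ b) ⊕ l ⊜ (a ⊕ l) ⊕ b) refl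
                   (a · e₀) (suc n · (toℕ t · e₀)) (lc c (tail e)) ⟩
            (a · e₀ ⊞ lc c (tail e)) ⊞ suc n · (toℕ t · e₀)
              ≈⟨ +-congʳ (cycle-sum (toℕ i) (toℕ s) eq) ⟨
            ((toℕ i · e₀ ⊞ y) ⊞ toℕ t · e₀) ⊞ suc n · (toℕ t · e₀)
              ≈⟨ +-congʳ (trans (+-congʳ sum≈0) (+-identityˡ (toℕ t · e₀))) ⟩
            p · (toℕ t · e₀)
              ≈⟨ p·x≈0 (toℕ t · e₀) ⟩
            0# ∎

          p∣ : ∀ j → p ∣ ((a + suc n * toℕ t) ∷ c) j
          p∣ = independent⇒∣ e ind ((a + suc n * toℕ t) ∷ c) lc≈0

          p∣suc : ∀ s t → s ≡ t → p ∣ suc (toℕ i) + toℕ s + suc n * toℕ t → p ∣ suc (toℕ i)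
          p∣suc s .s ≡.refl p∣ = ∣m+n∣m⇒∣n (≡.subst (p ∣_)
            (+-*-Solver.solve 3 (λ i s n → (con 1 :+ i) :+ s :+ (con 1 :+ n) :* s
              := s :* (con 2 :+ n) :+ (con 1 :+ i)) ≡.refl (toℕ i) (toℕ s) n) p∣) (n∣m*n (toℕ s))
            where open +-*-Solver using (_:+_; _:*_; _:=_; con)

      cycle⊆units : ∀ {x} → ⟦_⟧ cycle x → Nonzero x
      cycle⊆units {x} x∈ x≈0 =
        let i , y , y∈ , x≈ = ∈-uncons 𝔽⁺ cycle x∈
            s , t , c , run , eq = chain⁻ e₀ e₀ (tail e) ind closes y∈
        in cycle-sum≉0 i s t y c run eq (trans (sym x≈) x≈0)

      units⊆cycle : f ≤ 2 + k → ∀ {x} → Nonzero x → ⟦_⟧ cycle x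
      units⊆cycle f≤2+k {x} x≉0 with independent⇒spanning f≤2+k e ind x
      ... | b , x≈b =
        let i , s , t , run , a₀+t≋ = closed-run (a zero) (tail a) nonzero
            y , y∈ , eq = chain⁺ e₀ e₀ (tail e) ind closes s t (toℕ ∘ tail a) run
        -- The target and the constructed point are compared after adding t·e₀, the form in which
        -- `chain⁺` delivers the point.
        in ∈-cons 𝔽⁺ cycle i y∈ (∙-cancelʳ (toℕ t · e₀) x (toℕ i · e₀ ⊞ y) (begin
          x ⊞ toℕ t · e₀
            ≈⟨ +-congʳ x≈ ⟩
          (toℕ (a zero) · e₀ ⊞ lc (toℕ ∘ tail a) (tail e)) ⊞ toℕ t · e₀
            ≈⟨ solve 3 (λ m l b → (m ⊕ l) ⊕ b ⊜ (m ⊕ b) ⊕ l) refl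
                 (toℕ (a zero) · e₀) (lc (toℕ ∘ tail a) (tail e)) (toℕ t · e₀) ⟩
          (toℕ (a zero) · e₀ ⊞ toℕ t · e₀) ⊞ lc (toℕ ∘ tail a) (tail e)
            ≈⟨ +-congʳ (×-homo-+ e₀ (toℕ (a zero)) (toℕ t)) ⟨
          (toℕ (a zero) + toℕ t) · e₀ ⊞ lc (toℕ ∘ tail a) (tail e)
            ≈⟨ +-congʳ (≋⇒≈ a₀+t≋ e₀) ⟩
          (suc (toℕ i) + toℕ s) · e₀ ⊞ lc (toℕ ∘ tail a) (tail e)
            ≈⟨ cycle-sum (toℕ i) (toℕ s) eq ⟨
          (toℕ i · e₀ ⊞ y) ⊞ toℕ t · e₀ ∎))
        where
        a : Fin (2 + k) → Fin p
        a j = b j mod p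

        x≈ : x ≈ lc (toℕ ∘ a) e
        x≈ = trans x≈b (sym (lc-cong (toℕ ∘ a) b e (reduce ∘ b)))

        split : (∃ λ j → a j ≢ zero) → a zero ≢ zero ⊎ (∃ λ j → tail a j ≢ zero)
        split (zero  , a₀≢0) = inj₁ a₀≢0
        split (suc j , aⱼ≢0) = inj₂ (j , aⱼ≢0)

        nonzero : a zero ≢ zero ⊎ (∃ λ j → tail a j ≢ zero)
        nonzero with all? (λ j → a j Fin.≟ zero)
        ... | yes a≡0 = contradiction
          (trans x≈ (lc-∣ (toℕ ∘ a) e (λ j → ≡.subst (λ m → p ∣ toℕ m) (≡.sym (a≡0 j)) (p ∣0)))) x≉0
        ... | no  a≢0 = split (¬∀⟶∃¬ _ _ (λ j → a j Fin.≟ zero) a≢0)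

    units-cycle : 1 < f → ∃ λ r → r ≤ 2 * f × Σ (GAPRep 𝔽⁺ r) λ P → (Nonzero ≐ ⟦_⟧ P) × Improper P
    units-cycle 1<f =
      (2 + k) * 2 , ℕ.≤-reflexive (≡.trans (≡.cong (_* 2) 2+k≡f) (ℕ.*-comm f 2)) ,
      -- Improperness comes from the absence of any proper representation when f > 1.
      P , units≐P , λ proper → units-not-properGAP 1<f ((2 + k) * 2 , P , units≐P , proper)
      where
      k : ℕ
      k = f ∸ 2

      2+k≡f : 2 + k ≡ f
      2+k≡f = ℕ.m+[n∸m]≡n 1<f

      basis : ∃ λ (e : Vector Carrier (2 + k)) → Independent e
      basis = ∃-independent (2 + k) (ℕ.≤-reflexive 2+k≡f)

      P : GAPRep 𝔽⁺ ((2 + k) * 2)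
      P = cycle (proj₁ basis) (proj₂ basis)

      units≐P : Nonzero ≐ ⟦_⟧ P
      units≐P = units⊆cycle (proj₁ basis) (proj₂ basis) (ℕ.≤-reflexive (≡.sym 2+k≡f))
              , cycle⊆units (proj₁ basis) (proj₂ basis)

    units-GAP : f ≡ 1 ⊎ 1 < f → IsGAP 𝔽⁺ Nonzero
    units-GAP (inj₂ 1<f) = let r , _ , P , units≐P , _ = units-cycle 1<f in r , P , units≐P
    units-GAP (inj₁ f≡1) = 1 , P , fwd , bwd
      where
      P : GAPRep 𝔽⁺ 1
      P = consRep 𝔽⁺ (suc n) 1# (s≤s 1≤n) (0≉1 ∘ sym) (pointRep 𝔽⁺ 1#)

      fwd : ∀ {x} → Nonzero x → ⟦_⟧ P x
      fwd x≉0 = let i , x≈ = proj₁ (units-AP f≡1) x≉0 in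
        (λ { zero → i }) , trans x≈ (sym (+-congˡ (+-identityʳ _)))

      bwd : ∀ {x} → ⟦_⟧ P x → Nonzero x
      bwd (b , x≈) = proj₂ (units-AP f≡1) (b zero , trans x≈ (+-congˡ (+-identityʳ _)))

  -- Characteristic two.

  char2-GAP⇒prime : n ≡ 0 → IsGAP 𝔽⁺ Nonzero → ¬ 1 < f
  char2-GAP⇒prime n≡0 (zero  , P , units≐P) 1<f = rank0≠units 1<f P units≐P
  char2-GAP⇒prime n≡0 (suc r , P , units≐P) 1<f =
    -- In positive rank this asks for 2 ≤ L < p = 2.
    ℕ.<⇒≱ (≡.subst (λ n → len P zero < 2 + n) n≡0 (length<p P units≐P)) (len≥2 P zero)

  -- Here p - 1 = 1, so the units form the singleton {1}, of rank zero.
  char2-prime⇒GAP : n ≡ 0 → f ≡ 1 → IsGAP 𝔽⁺ Nonzero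
  char2-prime⇒GAP n≡0 f≡1 = 0 , pointRep 𝔽⁺ 1# , fwd , bwd
    where
    fwd : ∀ {x} → Nonzero x → ⟦_⟧ (pointRep 𝔽⁺ 1#) x
    fwd x≉0 = let i , x≈ = proj₁ (units-AP f≡1) x≉0 in
      (λ ()) , trans x≈ (reflexive (≡.cong (λ j → suc j · 1#)
        (ℕ.n<1⇒n≡0 (≡.subst (λ n → toℕ i < suc n) n≡0 (toℕ<n i)))))

    bwd : ∀ {x} → ⟦_⟧ (pointRep 𝔽⁺ 1#) x → Nonzero x
    bwd (_ , x≈) x≈0 = 0≉1 (trans (sym x≈0) (trans x≈ (+-identityʳ 1#)))

theorem1p3 : ∀ {c ℓ : Level} (p f : ℕ) → Prime p → 1 ≤ f →
    (F : FiniteField c ℓ (p ^ f)) →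
    let 𝔽⁺ = FiniteField.+-abelianGroup F
        𝔽ˣ = FiniteField.Nonzero F
    in
    (¬ (2 ∣ p) →
       IsGAP 𝔽⁺ 𝔽ˣ
       × (f ≡ 1 → IsArithmeticProgression 𝔽⁺ 𝔽ˣ)
       × (1 < f →
            ¬ IsProperGAP 𝔽⁺ 𝔽ˣ
            × (∃ λ r → r ≤ 2 * f ×
                 Σ (GAPRep 𝔽⁺ r) λ P → (𝔽ˣ ≐ GAPRep.⟦_⟧ P) × GAPRep.Improper P)))
    × (p ≡ 2 → IsGAP 𝔽⁺ 𝔽ˣ ⇔ p ^ f ≡ 2)
theorem1p3 zero          f p-prime 1≤f F = contradiction p-prime ¬prime[0]
theorem1p3 (suc zero)    f p-prime 1≤f F = contradiction p-prime ¬prime[1]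
theorem1p3 (suc (suc n)) f p-prime 1≤f F = odd , even
  where
  open FiniteFieldOf n f p-prime F
  open FiniteField F using (1#; Nonzero)

  odd : ¬ (2 ∣ 2 + n) →
        IsGAP 𝔽⁺ Nonzero
        × (f ≡ 1 → IsArithmeticProgression 𝔽⁺ Nonzero)
        × (1 < f → ¬ IsProperGAP 𝔽⁺ Nonzero
                   × (∃ λ r → r ≤ 2 * f ×
                        Σ (GAPRep 𝔽⁺ r) λ P → (Nonzero ≐ GAPRep.⟦_⟧ P) × GAPRep.Improper P))
  odd 2∤p = units-GAP 1≤n f-cases
          , (λ f≡1 → 1# , 1# , suc n , units-AP f≡1)
          , λ 1<f → units-not-properGAP 1<f , units-cycle 1≤n 1<f
    where
    1≤n : 1 ≤ n
    1≤n = ℕ.n≢0⇒n>0 λ n≡0 → 2∤p (divides 1 (≡.cong (2 +_) n≡0))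

    f-cases : f ≡ 1 ⊎ 1 < f
    f-cases with ℕ.m≤n⇒m<n∨m≡n 1≤f
    ... | inj₁ 1<f = inj₂ 1<f
    ... | inj₂ 1≡f = inj₁ (≡.sym 1≡f)

  even : 2 + n ≡ 2 → IsGAP 𝔽⁺ Nonzero ⇔ (2 + n) ^ f ≡ 2
  even 2+n≡2 = mk⇔ (λ gap → order (ℕ.≤-antisym (ℕ.≮⇒≥ (char2-GAP⇒prime n≡0 gap)) 1≤f))
                   (λ q≡2 → char2-prime⇒GAP n≡0 (degree q≡2))
    where
    n≡0 : n ≡ 0
    n≡0 = ℕ.+-cancelˡ-≡ 2 n 0 2+n≡2

    order : f ≡ 1 → (2 + n) ^ f ≡ 2
    order f≡1 = ≡.trans (≡.cong₂ _^_ 2+n≡2 f≡1) ≡.refl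

    degree : (2 + n) ^ f ≡ 2 → f ≡ 1
    degree q≡2 = ℕ.≤-antisym (ℕ.≮⇒≥ λ 1<f →
      ℕ.<-irrefl (≡.sym (≡.trans (≡.cong (_^ f) (≡.sym 2+n≡2)) q≡2)) (ℕ.^-monoʳ-< 2 (s<s z<s) 1<f)) 1≤f
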